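{- There exist a constant $c>0$ and an infinite family of 3-layered DAGs $G = (V = V_1 \cup V_2 \cup V_3, E, w)$ with positive edge weights and with $|V|$ unbounded over the family, such that for every $G$ in the family $|V_2| = 3$ and every gap-1 shortest-paths preserver $H = (V, E, w_H)$ of $G$ satisfies $$\max_{e \in E} w_H(e) \ge 2^{c|V|}$$ (that is, $\max_{e\in E} w_H(e) \ge 2^{\Omega(|V|)}$).
   Context: Graphs are finite. A 3-layered DAG is a directed graph whose vertex set is a disjoint union $V = V_1 \cup V_2 \cup V_3$ and all of whose edges go from $V_1$ to $V_2$ or from $V_2$ to $V_3$. Edge weights $w$ are positive reals; the weight of a path is the sum of the weights of its edges; a shortest path is a directed path of minimum weight between its endpoints. Given $G=(V,E,w)$, a graph $H=(V,E,w_H)$ on the same vertex and edge set with positive real edge weights $w_H$ is a shortest-paths preserver of $G$ if every shortest path $\pi$ in $H$ is (as a sequence of vertices and edges) also a shortest path in $G$. It is a gap-1 shortest-paths preserver if, in addition, for any shortest path $\pi$ in $H$ and any path $\pi'$ with the same endpoints that is not a shortest path in $H$, we have $w_H(\pi)+1\le w_H(\pi')$. -}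

module Defs where

open import Data.Nat as ℕ using (ℕ; zero; suc; s≤s; z≤n; NonZero)
import Data.Nat.Properties as ℕ
open import Data.Nat.Tactic.RingSolver using (solve-∀)
open import Data.Integer as ℤ using (+_; -[1+_])
import Data.Integer.Properties as ℤ
open import Data.Rational as ℚ using (ℚ; mkℚ; 0ℚ; 1ℚ; ½; _/_; *<*; toℚᵘ)
import Data.Rational.Properties as ℚ
open import Data.Rational.Solver using (module +-*-Solver)
import Data.Rational.Unnormalised as ℚᵘ
import Data.Rational.Unnormalised.Properties as ℚᵘ
open import Data.Fin using (Fin)
open import Data.Vec.Functional using (foldr)
open import Data.Sum using (_⊎_; inj₁; inj₂)
open import Data.Product using (∃; _×_; _,_)
open import Relation.Nullary using (¬_; Dec; yes; no; contradiction)
open import Relation.Binary.PropositionalEquality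

-- Real numbers as Cauchy sequences of rationals; equality of reals is ≤ᴿ in
-- both directions, not _≡_.
record ℝ : Set where
  field
    seq    : ℕ → ℚ
    -- m and n are interchangeable, so this is ∣ seq m - seq n ∣ ≤ ε.
    cauchy : ∀ ε → 0ℚ ℚ.< ε →
             ∃ λ N → ∀ m n → N ℕ.≤ m → N ℕ.≤ n → seq m ℚ.≤ seq n ℚ.+ ε
open ℝ public

infix  4 _≤ᴿ_ _<ᴿ_
infixl 6 _+ᴿ_ _⊔ᴿ_

_≤ᴿ_ : ℝ → ℝ → Set
x ≤ᴿ y = ∀ ε → 0ℚ ℚ.< ε →
         ∃ λ N → ∀ n → N ℕ.≤ n → seq x n ℚ.≤ seq y n ℚ.+ ε

_<ᴿ_ : ℝ → ℝ → Set
x <ᴿ y = ∃ λ ε → 0ℚ ℚ.< ε ×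
         ∃ λ N → ∀ n → N ℕ.≤ n → seq x n ℚ.+ ε ℚ.≤ seq y n

fromℚ : ℚ → ℝ
fromℚ q = record
  { seq    = λ _ → q
  ; cauchy = λ ε 0<ε → 0 , λ _ _ _ _ →
      subst (ℚ._≤ q ℚ.+ ε) (ℚ.+-identityʳ q) (ℚ.+-monoʳ-≤ q (ℚ.<⇒≤ 0<ε))
  }

0ᴿ 1ᴿ : ℝ
0ᴿ = fromℚ 0ℚ
1ᴿ = fromℚ 1ℚ

_+ᴿ_ : ℝ → ℝ → ℝ
seq    (x +ᴿ y) n = seq x n ℚ.+ seq y n
cauchy (x +ᴿ y) ε 0<ε =
  let 0<ε/2    = subst (ℚ._< ½ ℚ.* ε) (ℚ.*-zeroʳ ½) (ℚ.*-monoʳ-<-pos ½ 0<ε)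
      (M , xC) = cauchy x (½ ℚ.* ε) 0<ε/2
      (N , yC) = cauchy y (½ ℚ.* ε) 0<ε/2
  in M ℕ.⊔ N , λ m n ≤m ≤n →
     subst (seq x m ℚ.+ seq y m ℚ.≤_) (halves (seq x n) (seq y n) ε)
       (ℚ.+-mono-≤
         (xC m n (ℕ.≤-trans (ℕ.m≤m⊔n M N) ≤m) (ℕ.≤-trans (ℕ.m≤m⊔n M N) ≤n))
         (yC m n (ℕ.≤-trans (ℕ.m≤n⊔m M N) ≤m) (ℕ.≤-trans (ℕ.m≤n⊔m M N) ≤n)))
  where
  open +-*-Solver
  halves : ∀ p q e → (p ℚ.+ ½ ℚ.* e) ℚ.+ (q ℚ.+ ½ ℚ.* e) ≡ (p ℚ.+ q) ℚ.+ e
  halves = solve 3 (λ p q e → (p :+ con ½ :* e) :+ (q :+ con ½ :* e) := (p :+ q) :+ e) refl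

_⊔ᴿ_ : ℝ → ℝ → ℝ
seq    (x ⊔ᴿ y) n = seq x n ℚ.⊔ seq y n
cauchy (x ⊔ᴿ y) ε 0<ε =
  let (M , xC) = cauchy x ε 0<ε
      (N , yC) = cauchy y ε 0<ε
  in M ℕ.⊔ N , λ m n ≤m ≤n → ℚ.⊔-lub
       (ℚ.≤-trans
         (xC m n (ℕ.≤-trans (ℕ.m≤m⊔n M N) ≤m) (ℕ.≤-trans (ℕ.m≤m⊔n M N) ≤n))
         (ℚ.+-monoˡ-≤ ε (ℚ.p≤p⊔q (seq x n) (seq y n))))
       (ℚ.≤-trans
         (yC m n (ℕ.≤-trans (ℕ.m≤n⊔m M N) ≤m) (ℕ.≤-trans (ℕ.m≤n⊔m M N) ≤n))
         (ℚ.+-monoˡ-≤ ε (ℚ.p≤q⊔p (seq x n) (seq y n))))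

largest : {P : ℕ → Set} → (∀ j → Dec (P j)) → ℕ → ℕ
largest P? zero = 0
largest P? (suc B) with P? (suc B)
... | yes _ = suc B
... | no  _ = largest P? B

largest-sat : ∀ {P : ℕ → Set} (P? : ∀ j → Dec (P j)) B → P 0 → P (largest P? B)
largest-sat P? zero    P0 = P0
largest-sat P? (suc B) P0 with P? (suc B)
... | yes p = p
... | no  _ = largest-sat P? B P0

largest-max : ∀ {P : ℕ → Set} (P? : ∀ j → Dec (P j)) B {j} → j ℕ.≤ B → P j →
              j ℕ.≤ largest P? B
largest-max P? zero    j≤B Pj = j≤B
largest-max P? (suc B) j≤B Pj with P? (suc B)
... | yes _ = j≤B
... | no ¬p with ℕ.m≤n⇒m<n∨m≡n j≤B
...   | inj₁ (s≤s j≤B′) = largest-max P? B j≤B′ Pj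
...   | inj₂ refl       = contradiction Pj ¬p

-- root b N D is the b-th root of N / D: its k-th approximation is the
-- largest fraction j / (k + 1) with (j / (k + 1)) ^ b ≤ N / D.
module _ (b N D : ℕ) .{{_ : NonZero b}} .{{_ : NonZero D}} where

  RootBound : ℕ → ℕ → Set
  RootBound k j = D ℕ.* j ℕ.^ b ℕ.≤ N ℕ.* suc k ℕ.^ b

  rootBound? : ∀ k j → Dec (RootBound k j)
  rootBound? k j = D ℕ.* j ℕ.^ b ℕ.≤? N ℕ.* suc k ℕ.^ b

  rootNum : ℕ → ℕ
  rootNum k = largest (rootBound? k) (N ℕ.* suc k)

  private
    0^b≡0 : ∀ b .{{_ : NonZero b}} → 0 ℕ.^ b ≡ 0
    0^b≡0 (suc b) = refl

    m≤m^b : ∀ m b .{{_ : NonZero b}} → m ℕ.≤ m ℕ.^ b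
    m≤m^b zero    b       = z≤n
    m≤m^b (suc m) (suc b) = ℕ.m≤m*n (suc m) (suc m ℕ.^ b) {{ℕ.m^n≢0 (suc m) b}}

    ^-distribʳ-* : ∀ x y b → (x ℕ.* y) ℕ.^ b ≡ x ℕ.^ b ℕ.* y ℕ.^ b
    ^-distribʳ-* x y zero    = refl
    ^-distribʳ-* x y (suc b) = trans (cong (x ℕ.* y ℕ.*_) (^-distribʳ-* x y b))
                                     (swap x y (x ℕ.^ b) (y ℕ.^ b))
      where
      swap : ∀ p q r s → p ℕ.* q ℕ.* (r ℕ.* s) ≡ p ℕ.* r ℕ.* (q ℕ.* s)
      swap = solve-∀

    swap₂ : ∀ p q r → p ℕ.* (q ℕ.* r) ≡ p ℕ.* q ℕ.* r
    swap₂ = solve-∀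

    swap₃ : ∀ p q r → p ℕ.* q ℕ.* r ≡ p ℕ.* r ℕ.* q
    swap₃ = solve-∀

    ^-cancel-≤ : ∀ {x y} → x ℕ.^ b ℕ.≤ y ℕ.^ b → x ℕ.≤ y
    ^-cancel-≤ {x} {y} le with x ℕ.≤? y
    ... | yes p = p
    ... | no ¬p = contradiction (ℕ.<-≤-trans (ℕ.^-monoˡ-< b (ℕ.≰⇒> ¬p)) le) (ℕ.<-irrefl refl)

  rootBound-sat : ∀ k → RootBound k (rootNum k)
  rootBound-sat k = largest-sat (rootBound? k) (N ℕ.* suc k)
    (subst (ℕ._≤ N ℕ.* suc k ℕ.^ b)
           (sym (trans (cong (D ℕ.*_) (0^b≡0 b)) (ℕ.*-zeroʳ D))) z≤n)

  rootBound-max : ∀ k {j} → RootBound k j → j ℕ.≤ rootNum k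
  rootBound-max k {j} bd = largest-max (rootBound? k) (N ℕ.* suc k) j≤NK bd
    where
    open ℕ.≤-Reasoning
    j≤NK : j ℕ.≤ N ℕ.* suc k
    j≤NK = ^-cancel-≤ (begin
      j ℕ.^ b                  ≤⟨ ℕ.m≤n*m (j ℕ.^ b) D ⟩
      D ℕ.* j ℕ.^ b            ≤⟨ bd ⟩
      N ℕ.* suc k ℕ.^ b        ≤⟨ ℕ.*-monoˡ-≤ (suc k ℕ.^ b) (m≤m^b N b) ⟩
      N ℕ.^ b ℕ.* suc k ℕ.^ b  ≡⟨ ^-distribʳ-* N (suc k) b ⟨
      (N ℕ.* suc k) ℕ.^ b      ∎)

  private
    cross : ∀ m n → rootNum m ℕ.* suc n ℕ.≤ suc (rootNum n) ℕ.* suc m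
    cross m n with rootNum m ℕ.* suc n ℕ.≤? suc (rootNum n) ℕ.* suc m
    ... | yes p = p
    ... | no ¬p = contradiction (rootBound-max n bd) (ℕ.<-irrefl refl)
      where
      open ℕ.≤-Reasoning
      i = rootNum m
      j = suc (rootNum n)
      bd : RootBound n j
      bd = ℕ.*-cancelʳ-≤ _ _ (suc m ℕ.^ b) {{ℕ.m^n≢0 (suc m) b}} (begin
        D ℕ.* j ℕ.^ b ℕ.* suc m ℕ.^ b      ≡⟨ swap₂ D (j ℕ.^ b) (suc m ℕ.^ b) ⟨
        D ℕ.* (j ℕ.^ b ℕ.* suc m ℕ.^ b)    ≡⟨ cong (D ℕ.*_) (^-distribʳ-* j (suc m) b) ⟨
        D ℕ.* (j ℕ.* suc m) ℕ.^ b          ≤⟨ ℕ.*-monoʳ-≤ D (ℕ.^-monoˡ-≤ b (ℕ.<⇒≤ (ℕ.≰⇒> ¬p))) ⟩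
        D ℕ.* (i ℕ.* suc n) ℕ.^ b          ≡⟨ cong (D ℕ.*_) (^-distribʳ-* i (suc n) b) ⟩
        D ℕ.* (i ℕ.^ b ℕ.* suc n ℕ.^ b)    ≡⟨ swap₂ D (i ℕ.^ b) (suc n ℕ.^ b) ⟩
        D ℕ.* i ℕ.^ b ℕ.* suc n ℕ.^ b      ≤⟨ ℕ.*-monoˡ-≤ (suc n ℕ.^ b) (rootBound-sat m) ⟩
        N ℕ.* suc m ℕ.^ b ℕ.* suc n ℕ.^ b  ≡⟨ swap₃ N (suc m ℕ.^ b) (suc n ℕ.^ b) ⟩
        N ℕ.* suc n ℕ.^ b ℕ.* suc m ℕ.^ b  ∎)

    -- i / (m + 1) ≤ j / (n + 1) + ε once i / (m + 1) ≤ (j + 1) / (n + 1)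
    -- and n is at least the denominator of ε.
    approx : ∀ ε → 0ℚ ℚ.< ε → ∀ i j m n → ℚ.↧ₙ ε ℕ.≤ n →
             i ℕ.* suc n ℕ.≤ suc j ℕ.* suc m →
             (+ i) / suc m ℚ.≤ (+ j) / suc n ℚ.+ ε
    approx (mkℚ (+ zero) d-1 _) (*<* (ℤ.+<+ ()))
    approx (mkℚ -[1+ _ ] d-1 _) (*<* ())
    approx ε@(mkℚ (+ suc a) d-1 _) 0<ε i j m n d≤n le =
      ℚ.toℚᵘ-cancel-≤ (begin
        toℚᵘ ((+ i) / suc m)                  ≃⟨ ℚ.toℚᵘ-fromℚᵘ (ℚᵘ.mkℚᵘ (+ i) m) ⟩
        ℚᵘ.mkℚᵘ (+ i) m                       ≤⟨ ℚᵘ.*≤* (subst₂ ℤ._≤_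
                                                   (ℤ.pos-* i (suc n ℕ.* d)) rhs (ℤ.+≤+ key)) ⟩
        ℚᵘ.mkℚᵘ (+ j) n ℚᵘ.+ toℚᵘ ε           ≃⟨ ℚᵘ.+-congˡ (toℚᵘ ε) (ℚ.toℚᵘ-fromℚᵘ (ℚᵘ.mkℚᵘ (+ j) n)) ⟨
        toℚᵘ ((+ j) / suc n) ℚᵘ.+ toℚᵘ ε      ≃⟨ ℚ.toℚᵘ-homo-+ ((+ j) / suc n) ε ⟨
        toℚᵘ ((+ j) / suc n ℚ.+ ε)            ∎)
      where
      open ℚᵘ.≤-Reasoning
      d = suc d-1
      rhs : + ((j ℕ.* d ℕ.+ suc a ℕ.* suc n) ℕ.* suc m)
          ≡ ((+ j) ℤ.* (+ d) ℤ.+ (+ suc a) ℤ.* (+ suc n)) ℤ.* (+ suc m)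
      rhs = trans (ℤ.pos-* (j ℕ.* d ℕ.+ suc a ℕ.* suc n) (suc m))
                  (cong (ℤ._* (+ suc m))
                    (trans (ℤ.pos-+ (j ℕ.* d) (suc a ℕ.* suc n))
                           (cong₂ ℤ._+_ (ℤ.pos-* j d) (ℤ.pos-* (suc a) (suc n)))))
      key : i ℕ.* (suc n ℕ.* d) ℕ.≤ (j ℕ.* d ℕ.+ suc a ℕ.* suc n) ℕ.* suc m
      key = R.begin
        i ℕ.* (suc n ℕ.* d)                        R.≡⟨ swap₂ i (suc n) d ⟩
        i ℕ.* suc n ℕ.* d                          R.≤⟨ ℕ.*-monoˡ-≤ d le ⟩
        suc j ℕ.* suc m ℕ.* d                      R.≡⟨ swap₃ (suc j) (suc m) d ⟩
        (d ℕ.+ j ℕ.* d) ℕ.* suc m                  R.≡⟨ cong (ℕ._* suc m) (ℕ.+-comm d (j ℕ.* d)) ⟩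
        (j ℕ.* d ℕ.+ d) ℕ.* suc m                  R.≤⟨ ℕ.*-monoˡ-≤ (suc m) (ℕ.+-monoʳ-≤ (j ℕ.* d)
                                                          (ℕ.≤-trans (ℕ.m≤n⇒m≤1+n d≤n) (ℕ.m≤n*m (suc n) (suc a)))) ⟩
        (j ℕ.* d ℕ.+ suc a ℕ.* suc n) ℕ.* suc m    R.∎
        where module R = ℕ.≤-Reasoning

  root : ℝ
  seq    root k = (+ rootNum k) / suc k
  cauchy root ε 0<ε = ℚ.↧ₙ ε , λ m n _ d≤n →
    approx ε 0<ε (rootNum m) (rootNum n) m n d≤n (cross m n)

infix 8 2^_

2^_ : ℚ → ℝ
2^ mkℚ (+ a)    b-1 _ = root (suc b-1) (2 ℕ.^ a) 1
2^ mkℚ -[1+ a ] b-1 _ = root (suc b-1) 1 (2 ℕ.^ suc a) {{_}} {{ℕ.m^n≢0 2 (suc a)}}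

record Digraph (V : Set) : Set where
  field
    edges   : ℕ
  E = Fin edges
  field
    src tgt : E → V
    simple  : ∀ {e f} → src e ≡ src f → tgt e ≡ tgt f → e ≡ f

module _ {V : Set} (G : Digraph V) where
  open Digraph G

  record Weighting : Set where
    field
      weight   : E → ℝ
      positive : ∀ e → 0ᴿ <ᴿ weight e

  data Path : V → V → Set where
    []  : ∀ {u} → Path u u
    _∷_ : ∀ {v} (e : E) → Path (tgt e) v → Path (src e) v

module _ {V : Set} {G : Digraph V} where
  open Weighting

  pathWeight : Weighting G → ∀ {u v} → Path G u v → ℝ
  pathWeight w []      = 0ᴿ
  pathWeight w (e ∷ π) = weight w e +ᴿ pathWeight w π

  IsShortest : Weighting G → ∀ {u v} → Path G u v → Set
  IsShortest w {u} {v} π = ∀ (π′ : Path G u v) → pathWeight w π ≤ᴿ pathWeight w π′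

  IsPreserver : (w wH : Weighting G) → Set
  IsPreserver w wH = ∀ {u v} (π : Path G u v) → IsShortest wH π → IsShortest w π

  IsGap1Preserver : (w wH : Weighting G) → Set
  IsGap1Preserver w wH = IsPreserver w wH ×
    (∀ {u v} (π π′ : Path G u v) → IsShortest wH π → ¬ IsShortest wH π′ →
       pathWeight wH π +ᴿ 1ᴿ ≤ᴿ pathWeight wH π′)

  -- Weights are positive, so starting the fold at 0 does not affect the
  -- maximum; it only makes the maximum over an empty edge set 0.
  maxWeight : Weighting G → ℝ
  maxWeight w = foldr _⊔ᴿ_ 0ᴿ (weight w)

Layers : (n₁ n₂ n₃ : ℕ) → Set
Layers n₁ n₂ n₃ = Fin n₁ ⊎ Fin n₂ ⊎ Fin n₃

data _↝_ {n₁ n₂ n₃ : ℕ} : (u v : Layers n₁ n₂ n₃) → Set where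
  V₁↝V₂ : ∀ {i j} → inj₁ i ↝ inj₂ (inj₁ j)
  V₂↝V₃ : ∀ {j k} → inj₂ (inj₁ j) ↝ inj₂ (inj₂ k)

record Weighted3LayeredDAG : Set where
  field
    ∣V₁∣ ∣V₂∣ ∣V₃∣ : ℕ
    graph   : Digraph (Layers ∣V₁∣ ∣V₂∣ ∣V₃∣)
    layered : ∀ e → Digraph.src graph e ↝ Digraph.tgt graph e
    w       : Weighting graph

  ∣V∣ : ℕ
  ∣V∣ = ∣V₁∣ ℕ.+ ∣V₂∣ ℕ.+ ∣V₃∣

{- Number the vertices of V₂ by 1, 2, 3.  A vertex of V₃ joined to only two of
them, with edge weights y and y′, is a threshold: a vertex of V₁ with weights
x and x′ to the same two vertices prefers the first iff x − x′ < y′ − y.  Let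
A_t, B_t, C_t be thresholds on the pairs (1, 2), (2, 3), (3, 1), and write δ for
the difference y − y′ of a threshold.

If a vertex of V₁ prefers the first vertex of all three pairs of A_a, B_b, C_c,
summing around the cycle cancels its own weights and leaves
δA_a + δB_b + δC_c < 0; the opposite preferences give > 0.  Vertices p_t, q_t,
r_t of V₁ realise > 0 at (A_t, B_t, C_t) and < 0 at (A_t, B_{t+1}, C_0) and
(A_t, B_0, C_{t+1}).  Hence D_t = δA_t + δB_0 + δC_0 satisfies
D_{t+1} > − δB_{t+1} − δC_{t+1} + δB_0 + δC_0 > 2 D_t.  With gap 1 also D_0 ≥ 1,
and D_t is at most three times the maximal weight.

Two-edge paths between such endpoints come in pairs, so in a preserver H the path
that is not shortest in G is not shortest in H either, and the other one is
shortest in H.  The real inequalities with gap 1 are turned into rational ones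
with gap 1/3, valid at all late indices of the approximating sequences. -}

module Submission where

open import Defs
open import Data.Nat as ℕ using (ℕ; zero; suc)
import Data.Nat.Properties as ℕ
open import Data.Nat.Tactic.RingSolver using (solve-∀)
open import Data.Integer as ℤ using (+_; -[1+_])
import Data.Integer.Properties as ℤ
open import Data.Rational as ℚ
  using (ℚ; mkℚ; 0ℚ; 1ℚ; ½; _<_; _≤_; _+_; _-_; _*_; _/_; *≤*)
import Data.Rational.Properties as ℚ
open import Data.Rational.Literals using (fromℤ)
open import Data.Rational.Solver using (module +-*-Solver)
import Data.Rational.Unnormalised as ℚᵘ
import Data.Rational.Unnormalised.Properties as ℚᵘ
open import Data.Fin as Fin using (Fin; zero; suc; toℕ; inject₁; combine)
open import Data.Fin.Patterns using (0F; 1F; 2F)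
import Data.Fin.Properties as Fin
open import Data.Fin.Induction using (<-weakInduction)
open import Data.Vec.Functional using (foldr)
open import Data.Product using (∃; _×_; _,_; proj₁; proj₂; uncurry)
open import Data.Product.Function.NonDependent.Propositional using (_×-↔_)
open import Data.Sum using (_⊎_; inj₁; inj₂)
open import Data.Sum.Properties using (inj₁-injective; inj₂-injective)
open import Data.Sum.Function.Propositional using (_⊎-↔_)
open import Algebra.Properties.CommutativeSemigroup ℕ.*-commutativeSemigroup using (interchange)
open import Function using (_∘_; _↔_; Inverse)
open import Function.Construct.Composition using (_↔-∘_)
open import Function.Construct.Identity using (↔-id)
open import Relation.Nullary using (¬_; yes; no; contradiction)
open import Relation.Nullary.Decidable using (from-no)
open import Relation.Binary.PropositionalEquality

open +-*-Solver
open Weighting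
open Weighted3LayeredDAG

-- Rational inequalities, and properties that hold from some index on.

-- Linear arithmetic by certificate: the hypotheses are added up to `l ≤ r`, and what remains is a
-- ring identity, which the solver can prove.
≤-by-difference : ∀ {l r a b} → l ≤ r → b - a ≡ r - l → a ≤ b
≤-by-difference {l} {r} {a} {b} l≤r eq = subst₂ _≤_
  (solve 2 (λ l a → l :+ (a :- l) := a) refl l a)
  (trans (solve 3 (λ l r a → r :+ (a :- l) := (r :- l) :+ a) refl l r a)
         (trans (cong (_+ a) (sym eq)) (solve 2 (λ a b → (b :- a) :+ a := b) refl a b)))
  (ℚ.+-monoˡ-≤ (a - l) l≤r)

fromℕ : ℕ → ℚ
fromℕ n = fromℤ (+ n)

fromℕ-mono-≤ : ∀ {m n} → m ℕ.≤ n → fromℕ m ≤ fromℕ n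
fromℕ-mono-≤ m≤n = *≤* (ℤ.*-monoʳ-≤-nonNeg (+ 1) (ℤ.+≤+ m≤n))

fromℕ-homo-+ : ∀ m n → fromℕ (m ℕ.+ n) ≡ fromℕ m + fromℕ n
fromℕ-homo-+ m n = ℚ.toℚᵘ-injective (ℚᵘ.≃-trans
  (ℚᵘ.*≡* (cong (ℤ._* + 1) (sym (cong₂ ℤ._+_ (ℤ.*-identityʳ (+ m)) (ℤ.*-identityʳ (+ n))))))
  (ℚᵘ.≃-sym (ℚ.toℚᵘ-homo-+ (fromℕ m) (fromℕ n))))

fromℕ-homo-* : ∀ m n → fromℕ (m ℕ.* n) ≡ fromℕ m * fromℕ n
fromℕ-homo-* m n = ℚ.toℚᵘ-injective (ℚᵘ.≃-trans
  (ℚᵘ.*≡* (cong (ℤ._* + 1) (ℤ.pos-* m n)))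
  (ℚᵘ.≃-sym (ℚ.toℚᵘ-homo-* (fromℕ m) (fromℕ n))))

Eventually : (ℕ → Set) → Set
Eventually P = ∃ λ N → ∀ n → N ℕ.≤ n → P n

always : {P : ℕ → Set} → (∀ n → P n) → Eventually P
always p = 0 , λ n _ → p n

infixl 4 _⊛_

_⊛_ : {P Q : ℕ → Set} → Eventually (λ n → P n → Q n) → Eventually P → Eventually Q
(M , f) ⊛ (N , p) = M ℕ.⊔ N , λ n ≤n →
  f n (ℕ.≤-trans (ℕ.m≤m⊔n M N) ≤n) (p n (ℕ.≤-trans (ℕ.m≤n⊔m M N) ≤n))

½*-pos : ∀ {ε} → 0ℚ < ε → 0ℚ < ½ * ε
½*-pos {ε} 0<ε = subst (_< ½ * ε) (ℚ.*-zeroʳ ½) (ℚ.*-monoʳ-<-pos ½ 0<ε)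

≤+pos : ∀ {p q ε} → 0ℚ < ε → p ≤ q → p ≤ q + ε
≤+pos {p} {q} 0<ε p≤q =
  subst (_≤ _) (ℚ.+-identityʳ p) (ℚ.+-mono-≤ p≤q (ℚ.<⇒≤ 0<ε))

-- If seq y K exceeds seq x K by more than twice the Cauchy modulus δ at one
-- index K, then y stays above x; otherwise y ≤ x + 4δ.
≰ᴿ⇒≥ᴿ : ∀ x y → ¬ x ≤ᴿ y → y ≤ᴿ x
≰ᴿ⇒≥ᴿ x y x≰y ε 0<ε = K , bound
  where
  δ = ½ * (½ * ε)
  0<δ : 0ℚ < δ
  0<δ = ½*-pos (½*-pos 0<ε)
  M = cauchy x δ 0<δ .proj₁
  N = cauchy y δ 0<δ .proj₁
  K = M ℕ.⊔ N
  x-close : ∀ m n → K ℕ.≤ m → K ℕ.≤ n → seq x m ≤ seq x n + δ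
  x-close m n ≤m ≤n = cauchy x δ 0<δ .proj₂ m n
    (ℕ.≤-trans (ℕ.m≤m⊔n M N) ≤m) (ℕ.≤-trans (ℕ.m≤m⊔n M N) ≤n)
  y-close : ∀ m n → K ℕ.≤ m → K ℕ.≤ n → seq y m ≤ seq y n + δ
  y-close m n ≤m ≤n = cauchy y δ 0<δ .proj₂ m n
    (ℕ.≤-trans (ℕ.m≤n⊔m M N) ≤m) (ℕ.≤-trans (ℕ.m≤n⊔m M N) ≤n)
  bound : ∀ n → K ℕ.≤ n → seq y n ≤ seq x n + ε
  bound n K≤n with seq y K ℚ.≤? seq x K + (δ + δ)
  ... | yes yK≤xK = ≤-by-difference
    (ℚ.+-mono-≤ (ℚ.+-mono-≤ (y-close n K K≤n ℕ.≤-refl) yK≤xK) (x-close K n ℕ.≤-refl K≤n))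
    (solve 5 (λ xn yn xK yK ε → let δ = con ½ :* (con ½ :* ε) in
        (xn :+ ε) :- yn := ((yK :+ δ) :+ (xK :+ (δ :+ δ)) :+ (xn :+ δ)) :- ((yn :+ yK) :+ xK))
      refl (seq x n) (seq y n) (seq x K) (seq y K) ε)
  ... | no yK≰xK = contradiction
    (λ ε′ 0<ε′ → K , λ m K≤m → ≤+pos {q = seq y m} 0<ε′ (≤-by-difference
      (ℚ.+-mono-≤ (ℚ.+-mono-≤ (x-close m K K≤m ℕ.≤-refl) (ℚ.<⇒≤ (ℚ.≰⇒> yK≰xK)))
        (y-close K m ℕ.≤-refl K≤m))
      (solve 5 (λ xm ym xK yK δ →
          ym :- xm := ((xK :+ δ) :+ yK :+ (ym :+ δ)) :- ((xm :+ (xK :+ (δ :+ δ))) :+ yK))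
        refl (seq x m) (seq y m) (seq x K) (seq y K) δ)))
    x≰y

≤-foldr-⊔ᴿ : ∀ {n} (f : Fin n → ℝ) i m → seq (f i) m ≤ seq (foldr _⊔ᴿ_ 0ᴿ f) m
≤-foldr-⊔ᴿ f zero    m = ℚ.p≤p⊔q _ _
≤-foldr-⊔ᴿ f (suc i) m = ℚ.≤-trans (≤-foldr-⊔ᴿ (f ∘ suc) i m) (ℚ.p≤q⊔p (seq (f zero) m) _)

-- Upper bounds for roots and powers of 2.

^-distribʳ-* : ∀ n k m → (n ℕ.* k) ℕ.^ m ≡ n ℕ.^ m ℕ.* k ℕ.^ m
^-distribʳ-* n k zero    = refl
^-distribʳ-* n k (suc m) =
  trans (cong (n ℕ.* k ℕ.*_) (^-distribʳ-* n k m)) (interchange n k (n ℕ.^ m) (k ℕ.^ m))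

-- The approximations of `root` lie below the root, so the bound holds at every index and not only
-- in the limit.
root-≤ : ∀ b N D M .{{_ : ℕ.NonZero b}} .{{_ : ℕ.NonZero D}} →
         N ℕ.≤ D ℕ.* M ℕ.^ b → ∀ k → seq (root b N D) k ≤ fromℕ M
root-≤ b N D M N≤DMᵇ k = ℚ.toℚᵘ-cancel-≤ (ℚᵘ.≤-respˡ-≃
  (ℚᵘ.≃-sym (ℚ.toℚᵘ-fromℚᵘ (ℚᵘ.mkℚᵘ (+ j) k)))
  (ℚᵘ.*≤* (subst₂ ℤ._≤_ (ℤ.pos-* j 1) (ℤ.pos-* M K)
    (ℤ.+≤+ (subst (ℕ._≤ M ℕ.* K) (sym (ℕ.*-identityʳ j)) (ℕ.≮⇒≥ j≮MK))))))
  where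
  K = suc k
  j = rootNum b N D k
  open ℕ.≤-Reasoning
  jᵇ≤ : j ℕ.^ b ℕ.≤ (M ℕ.* K) ℕ.^ b
  jᵇ≤ = ℕ.*-cancelˡ-≤ D (begin
    D ℕ.* j ℕ.^ b                   ≤⟨ rootBound-sat b N D k ⟩
    N ℕ.* K ℕ.^ b                   ≤⟨ ℕ.*-monoˡ-≤ (K ℕ.^ b) N≤DMᵇ ⟩
    D ℕ.* M ℕ.^ b ℕ.* K ℕ.^ b       ≡⟨ ℕ.*-assoc D (M ℕ.^ b) (K ℕ.^ b) ⟩
    D ℕ.* (M ℕ.^ b ℕ.* K ℕ.^ b)     ≡⟨ cong (D ℕ.*_) (^-distribʳ-* M K b) ⟨
    D ℕ.* (M ℕ.* K) ℕ.^ b           ∎)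
  j≮MK : ¬ M ℕ.* K ℕ.< j
  j≮MK lt = ℕ.<⇒≱ (ℕ.^-monoˡ-< b lt) jᵇ≤

2^-≤ : ∀ q n → q ≤ fromℕ n → ∀ k → seq (2^ q) k ≤ fromℕ (2 ℕ.^ n)
2^-≤ (mkℚ (+ a) b-1 _) n (*≤* le) = root-≤ (suc b-1) (2 ℕ.^ a) 1 (2 ℕ.^ n) (begin
    2 ℕ.^ a                        ≤⟨ ℕ.^-monoʳ-≤ 2 a≤nb ⟩
    2 ℕ.^ (n ℕ.* suc b-1)          ≡⟨ ℕ.^-*-assoc 2 n (suc b-1) ⟨
    (2 ℕ.^ n) ℕ.^ suc b-1          ≡⟨ ℕ.*-identityˡ _ ⟨
    1 ℕ.* (2 ℕ.^ n) ℕ.^ suc b-1    ∎)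
  where
  open ℕ.≤-Reasoning
  a≤nb : a ℕ.≤ n ℕ.* suc b-1
  a≤nb = ℤ.drop‿+≤+ (subst₂ ℤ._≤_ (ℤ.*-identityʳ (+ a)) (sym (ℤ.pos-* n (suc b-1))) le)
2^-≤ (mkℚ -[1+ a ] b-1 _) n _ =
  root-≤ (suc b-1) 1 (2 ℕ.^ suc a) (2 ℕ.^ n) {{_}} {{ℕ.m^n≢0 2 (suc a)}}
    (ℕ.*-mono-≤ (ℕ.m^n>0 2 (suc a)) (subst (1 ℕ.≤_) (sym (ℕ.^-*-assoc 2 n (suc b-1))) (ℕ.m^n>0 2 (n ℕ.* suc b-1))))

-- ≤ᴿ sees only the sequences, whereas _≡_ would also compare the Cauchy proofs.
infix 4 _≐_

_≐_ : ℝ → ℝ → Set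
x ≐ y = ∀ m → seq x m ≡ seq y m

≤ᴿ-refl : ∀ x → x ≤ᴿ x
≤ᴿ-refl x ε 0<ε = always λ n → ≤+pos {seq x n} {seq x n} 0<ε ℚ.≤-refl

≤ᴿ-resp-≐ : ∀ {x x′ y y′} → x ≐ x′ → y ≐ y′ → x ≤ᴿ y → x′ ≤ᴿ y′
≤ᴿ-resp-≐ x≐ y≐ x≤y ε 0<ε =
  always (λ n → subst₂ (λ p q → p ≤ q + ε) (x≐ n) (y≐ n)) ⊛ x≤y ε 0<ε

⅓ : ℚ
⅓ = + 1 / 3

-- The graph.

next : Fin 3 → Fin 3
next 0F = 1F
next 1F = 2F
next 2F = 0F

-- A vertex of V₃ of kind κ is joined to the vertices κ and next κ of V₂ only.
mid : Fin 3 → Fin 2 → Fin 3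
mid κ 0F = κ
mid κ 1F = next κ

other : Fin 2 → Fin 2
other 0F = 1F
other 1F = 0F

other-involutive : ∀ s → other (other s) ≡ s
other-involutive 0F = refl
other-involutive 1F = refl

same-or-other : ∀ s s′ → s′ ≡ s ⊎ s′ ≡ other s
same-or-other 0F 0F = inj₁ refl
same-or-other 0F 1F = inj₂ refl
same-or-other 1F 0F = inj₂ refl
same-or-other 1F 1F = inj₁ refl

mid-injective : ∀ κ {s s′} → mid κ s ≡ mid κ s′ → s ≡ s′
mid-injective κ  {0F} {0F} _  = refl
mid-injective κ  {1F} {1F} _  = refl
mid-injective 0F {0F} {1F} ()
mid-injective 1F {0F} {1F} ()
mid-injective 2F {0F} {1F} ()
mid-injective 0F {1F} {0F} ()
mid-injective 1F {1F} {0F} ()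
mid-injective 2F {1F} {0F} ()

-- In closed form 6 (2^t - 1). In the costs below B_t and C_t have δ = - `offset t`, and A_t has δ =
-- 3 + 2 `offset t`. The increment 6 makes the sum of δ equal to 3 at (A_t, B_t, C_t) and to -3 at
-- the other two triples, a margin of 1 per comparison.
offset : ℕ → ℕ
offset zero    = 0
offset (suc t) = 6 ℕ.+ 2 ℕ.* offset t

module Construction (n : ℕ) where

  size : ℕ
  size = 3 ℕ.* suc n

  -- (0F , t), (1F , t), (2F , t) stand for p_t, q_t, r_t in V₁ and for
  -- A_t, B_t, C_t in V₃.
  Label : Set
  Label = Fin 3 × Fin (suc n)

  code : Label → Fin size
  code = uncurry combine

  code-injective : ∀ {k l} → code k ≡ code l → k ≡ l
  code-injective {κ , t} {ι , u} eq =
    let κ≡ι , t≡u = Fin.combine-injective κ t ι u eq in cong₂ _,_ κ≡ι t≡u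

  Edge : Set
  Edge = (Label × Fin 3) ⊎ (Label × Fin 2)

  decoding : Fin (size ℕ.* 3 ℕ.+ size ℕ.* 2) ↔ Edge
  decoding = (pairing ⊎-↔ pairing) ↔-∘ Fin.+↔⊎
    where
    pairing : ∀ {k} → Fin (size ℕ.* k) ↔ (Label × Fin k)
    pairing = (Fin.*↔× ×-↔ ↔-id _) ↔-∘ Fin.*↔×

  open Inverse decoding renaming (to to decode; from to encode)

  decode-encode : ∀ a → decode (encode a) ≡ a
  decode-encode a = inverseˡ refl

  decode-injective : ∀ {e f} → decode e ≡ decode f → e ≡ f
  decode-injective {e} {f} eq = trans (sym (inverseʳ refl)) (trans (cong encode eq) (inverseʳ refl))

  decode≡⇒ : ∀ {e a} → decode e ≡ a → e ≡ encode a
  decode≡⇒ eq = decode-injective (trans eq (sym (decode-encode _)))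

  source target : Edge → Layers size 3 size
  source (inj₁ (l , j))       = inj₁ (code l)
  source (inj₂ ((κ , t) , s)) = inj₂ (inj₁ (mid κ s))
  target (inj₁ (l , j))       = inj₂ (inj₁ j)
  target (inj₂ (k , s))       = inj₂ (inj₂ (code k))

  endpoints-injective : ∀ a b → source a ≡ source b → target a ≡ target b → a ≡ b
  endpoints-injective (inj₁ (l , i)) (inj₁ (l′ , i′)) p q =
    cong₂ (λ l i → inj₁ (l , i)) (code-injective (inj₁-injective p))
      (inj₁-injective (inj₂-injective q))
  endpoints-injective (inj₂ (k , s)) (inj₂ (k′ , s′)) p q
    with refl ← code-injective {k} {k′} (inj₂-injective (inj₂-injective q))
    = cong (λ s → inj₂ (k , s)) (mid-injective (proj₁ k) (inj₁-injective (inj₂-injective p)))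

  digraph : Digraph (Layers size 3 size)
  digraph = record
    { edges  = size ℕ.* 3 ℕ.+ size ℕ.* 2
    ; src    = source ∘ decode
    ; tgt    = target ∘ decode
    ; simple = λ p q → decode-injective (endpoints-injective _ _ p q)
    }

  open Digraph digraph using (src; tgt)

  source↝target : ∀ a → source a ↝ target a
  source↝target (inj₁ _) = V₁↝V₂
  source↝target (inj₂ _) = V₂↝V₃

  module _ (wt : Weighting digraph) where

    X : Label → Fin 3 → ℝ
    X l j = weight wt (encode (inj₁ (l , j)))

    Y : Label → Fin 2 → ℝ
    Y k s = weight wt (encode (inj₂ (k , s)))

    viaWeight : Label → Label → Fin 2 → ℝ
    viaWeight l k s = X l (mid (proj₁ k) s) +ᴿ Y k s

  -- Paths from V₁ to V₃.

  v₁ v₃ : Label → Layers size 3 size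
  v₁ = inj₁ ∘ code
  v₃ = inj₂ ∘ inj₂ ∘ code

  v₂ : Fin 3 → Layers size 3 size
  v₂ = inj₂ ∘ inj₁

  -- The endpoints are passed as equations because `src (encode a)` equals `source a` only
  -- propositionally.
  cons : ∀ {u v x} e → src e ≡ u → tgt e ≡ x → Path digraph x v → Path digraph u v
  cons e refl refl π = e ∷ π

  pathWeight-cons : ∀ wt {u v x} e (p : src e ≡ u) (q : tgt e ≡ x) (π : Path digraph x v) →
    pathWeight wt (cons e p q π) ≐ weight wt e +ᴿ pathWeight wt π
  pathWeight-cons wt e refl refl π m = refl

  prepend : ∀ a {v} → Path digraph (target a) v → Path digraph (source a) v
  prepend a = cons (encode a) (cong source (decode-encode a)) (cong target (decode-encode a))

  pathWeight-prepend : ∀ wt a {v} (π : Path digraph (target a) v) →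
    pathWeight wt (prepend a π) ≐ weight wt (encode a) +ᴿ pathWeight wt π
  pathWeight-prepend wt a π =
    pathWeight-cons wt (encode a) (cong source (decode-encode a)) (cong target (decode-encode a)) π

  via : ∀ l k → Fin 2 → Path digraph (v₁ l) (v₃ k)
  via l k s = prepend (inj₁ (l , mid (proj₁ k) s)) (prepend (inj₂ (k , s)) [])

  pathWeight-via : ∀ wt l k s → pathWeight wt (via l k s) ≐ viaWeight wt l k s
  pathWeight-via wt l k s m = trans
    (pathWeight-prepend wt (inj₁ (l , mid (proj₁ k) s)) (prepend (inj₂ (k , s)) []) m)
    (cong (λ q → seq (X wt l (mid (proj₁ k) s)) m + q)
      (trans (pathWeight-prepend wt (inj₂ (k , s)) [] m) (ℚ.+-identityʳ _)))

  -- No edge leaves V₃. The endpoints are variables tied by equations since the index `src e` of a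
  -- path is not a constructor form, which would block matching at fixed endpoints.
  from-v₃ : ∀ {u v k k′} (π : Path digraph u v) → u ≡ v₃ k → v ≡ v₃ k′ → k ≡ k′ × (∀ wt → pathWeight wt π ≐ 0ᴿ)
  from-v₃ [] p q = code-injective (inj₂-injective (inj₂-injective (trans (sym p) q))) , λ _ _ → refl
  from-v₃ (e ∷ π) p q with decode e
  from-v₃ (e ∷ π) () q | inj₁ _
  from-v₃ (e ∷ π) () q | inj₂ _

  from-v₂ : ∀ {u v j k} (π : Path digraph u v) → u ≡ v₂ j → v ≡ v₃ k →
    ∃ λ s → mid (proj₁ k) s ≡ j × (∀ wt → pathWeight wt π ≐ Y wt k s)
  from-v₂ [] refl ()
  from-v₂ (e ∷ π) p q with decode e in eq
  from-v₂ (e ∷ π) () q | inj₁ _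
  from-v₂ {j = j} {k} (e ∷ π) p q | inj₂ (k′ , s)
    with refl , π-zero ← from-v₃ {k = k′} {k} π refl q =
      s , inj₁-injective (inj₂-injective p) ,
      λ wt m → trans (cong₂ _+_ (cong (λ e → seq (weight wt e) m) (decode≡⇒ eq)) (π-zero wt m)) (ℚ.+-identityʳ _)

  -- Reduces the quantifier over paths in `IsShortest` to a comparison of two weights.
  from-v₁ : ∀ {u v l k} (π : Path digraph u v) → u ≡ v₁ l → v ≡ v₃ k →
    ∃ λ s → ∀ wt → pathWeight wt π ≐ viaWeight wt l k s
  from-v₁ [] refl ()
  from-v₁ {l = l} (e ∷ π) p q with decode e in eq
  from-v₁ (e ∷ π) () q | inj₂ _
  from-v₁ {l = l} {k} (e ∷ π) p q | inj₁ (l′ , j)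
    with refl ← code-injective {l′} {l} (inj₁-injective p)
    with s , refl , π-weight ← from-v₂ {j = j} {k} π refl q =
      s , λ wt m → cong₂ _+_ (cong (λ e → seq (weight wt e) m) (decode≡⇒ eq)) (π-weight wt m)

  via-shortest : ∀ wt l k s → viaWeight wt l k s ≤ᴿ viaWeight wt l k (other s) →
    IsShortest wt (via l k s)
  via-shortest wt l k s s≤other π with from-v₁ {l = l} {k} π refl refl
  ... | s′ , π-weight with same-or-other s s′
  ...   | inj₁ refl = ≤ᴿ-resp-≐ {viaWeight wt l k s} {pathWeight wt (via l k s)} {viaWeight wt l k s} {pathWeight wt π}
                        (λ m → sym (pathWeight-via wt l k s m)) (λ m → sym (π-weight wt m))
                        (≤ᴿ-refl (viaWeight wt l k s))
  ...   | inj₂ refl = ≤ᴿ-resp-≐ {viaWeight wt l k s} {pathWeight wt (via l k s)} {viaWeight wt l k (other s)} {pathWeight wt π}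
                        (λ m → sym (pathWeight-via wt l k s m)) (λ m → sym (π-weight wt m))
                        s≤other

  -- The order on `ℝ` is not decidable, but refuting one of the two inequalities yields the other by
  -- `≰ᴿ⇒≥ᴿ`.
  other-not-shortest⇒≤ : ∀ wt l k s → ¬ IsShortest wt (via l k (other s)) →
    viaWeight wt l k s ≤ᴿ viaWeight wt l k (other s)
  other-not-shortest⇒≤ wt l k s ¬shortest = ≰ᴿ⇒≥ᴿ (viaWeight wt l k (other s)) (viaWeight wt l k s)
    (¬shortest ∘ via-shortest wt l k (other s) ∘
     subst (λ r → viaWeight wt l k (other s) ≤ᴿ viaWeight wt l k r) (sym (other-involutive s)))

  -- Every inequality that the argument uses holds here with a margin of exactly 1.
  -- The weights are these costs plus 1, which makes them positive.
  xCost : Label → Fin 3 → ℕ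
  xCost (0F , t) = λ { 0F → 0 ; 1F → 2 ℕ.+ 2 ℕ.* offset (toℕ t) ; 2F → 1 ℕ.+ offset (toℕ t) }
  xCost (1F , t) = λ { 0F → 1 ; 1F → 5 ℕ.+ 2 ℕ.* offset (toℕ t) ; 2F → 0 }
  xCost (2F , t) = λ { 0F → 0 ; 1F → 4 ℕ.+ 2 ℕ.* offset (toℕ t) ; 2F → 5 ℕ.+ 2 ℕ.* offset (toℕ t) }

  yCost : Label → Fin 2 → ℕ
  yCost (0F , t)    = λ { 0F → 3 ℕ.+ 2 ℕ.* offset (toℕ t) ; 1F → 0 }
  yCost (suc _ , t) = λ { 0F → 0 ; 1F → offset (toℕ t) }

  cost : Edge → ℕ
  cost (inj₁ (l , j)) = xCost l j
  cost (inj₂ (k , s)) = yCost k s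

  viaCost : Label → Label → Fin 2 → ℕ
  viaCost l k s = suc (xCost l (mid (proj₁ k) s)) ℕ.+ suc (yCost k s)

  Wins : Label → Fin 2 → Label → Set
  Wins l s k = viaCost l k s ℕ.< viaCost l k (other s)

  baseWeight : Weighting digraph
  baseWeight = record
    { weight   = λ e → fromℚ (fromℕ (suc (cost (decode e))))
    ; positive = λ e → 1ℚ , ℚ.positive⁻¹ 1ℚ , always λ _ → fromℕ-mono-≤ (ℕ.s≤s ℕ.z≤n)
    }

  viaWeight-base : ∀ l k s m → seq (viaWeight baseWeight l k s) m ≡ fromℕ (viaCost l k s)
  viaWeight-base l k s m = trans
    (cong₂ (λ a b → fromℕ (suc (cost a)) + fromℕ (suc (cost b)))
      (decode-encode (inj₁ (l , mid (proj₁ k) s))) (decode-encode (inj₂ (k , s))))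
    (sym (fromℕ-homo-+ (suc (xCost l (mid (proj₁ k) s))) (suc (yCost k s))))

  dag : Weighted3LayeredDAG
  dag = record
    { ∣V₁∣ = size ; ∣V₂∣ = 3 ; ∣V₃∣ = size
    ; graph = digraph ; layered = source↝target ∘ decode ; w = baseWeight }

  costlier-not-shortest : ∀ l k s → Wins l s k →
    ¬ IsShortest baseWeight (via l k (other s))
  costlier-not-shortest l k s lt shortest = 1≰½ (≤-by-difference
    (ℚ.+-mono-≤ (subst (_≤ fromℕ c′) (fromℕ-homo-+ 1 c) (fromℕ-mono-≤ lt)) c′≤c+½)
    (solve 2 (λ c c′ → con ½ :- con 1ℚ := (c′ :+ (c :+ con ½)) :- ((con 1ℚ :+ c) :+ c′)) refl (fromℕ c) (fromℕ c′)))
    where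
    c = viaCost l k s
    c′ = viaCost l k (other s)
    c′≤c+½ : fromℕ c′ ≤ fromℕ c + ½
    c′≤c+½ = let N , le = shortest (via l k s) ½ (ℚ.positive⁻¹ ½) in
      subst₂ (λ p q → p ≤ q + ½)
        (trans (pathWeight-via baseWeight l k (other s) N) (viaWeight-base l k (other s) N))
        (trans (pathWeight-via baseWeight l k s N) (viaWeight-base l k s N))
        (le N ℕ.≤-refl)
    1≰½ : ¬ 1ℚ ≤ ½
    1≰½ = from-no (1ℚ ℚ.≤? ½)

  module _ (wH : Weighting digraph) where

    lead : Label → ℕ → ℚ
    lead k m = seq (Y wH k 0F) m - seq (Y wH k 1F) m

    leads : (a b c : Fin (suc n)) → ℕ → ℚ
    leads a b c m = lead (0F , a) m + lead (1F , b) m + lead (2F , c) m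

  module _ (wH : Weighting digraph) (gap1 : IsGap1Preserver baseWeight wH) where

    beats : ∀ l k s → Wins l s k →
      Eventually λ m → seq (X wH l (mid (proj₁ k) s)) m + seq (Y wH k s) m + ⅓
                     ≤ seq (X wH l (mid (proj₁ k) (other s))) m + seq (Y wH k (other s)) m
    beats l k s lt = always remove-slack ⊛
      ≤ᴿ-resp-≐ {pathWeight wH (via l k s) +ᴿ 1ᴿ} {viaWeight wH l k s +ᴿ 1ᴿ}
                {pathWeight wH (via l k (other s))} {viaWeight wH l k (other s)}
        (λ m → cong (_+ 1ℚ) (pathWeight-via wH l k s m)) (pathWeight-via wH l k (other s))
        (proj₂ gap1 (via l k s) (via l k (other s))
          (via-shortest wH l k s (other-not-shortest⇒≤ wH l k s ¬shortest)) ¬shortest)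
        (⅓ + ⅓) (ℚ.positive⁻¹ (⅓ + ⅓))
      where
      ¬shortest : ¬ IsShortest wH (via l k (other s))
      ¬shortest = costlier-not-shortest l k s lt ∘ proj₁ gap1 (via l k (other s))
      remove-slack : ∀ m → seq (viaWeight wH l k s) m + 1ℚ ≤ seq (viaWeight wH l k (other s)) m + (⅓ + ⅓) →
        seq (viaWeight wH l k s) m + ⅓ ≤ seq (viaWeight wH l k (other s)) m
      remove-slack m le = ≤-by-difference le
        (solve 2 (λ p q → q :- (p :+ con ⅓) := (q :+ con (⅓ + ⅓)) :- (p :+ con 1ℚ)) refl
          (seq (viaWeight wH l k s) m) (seq (viaWeight wH l k (other s)) m))

    -- The three comparisons form a cycle through V₂, so the weights of the edges
    -- at l cancel in their sum.
    leads-≥1 : ∀ l a b c → Wins l 1F (0F , a) → Wins l 1F (1F , b) →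
      Wins l 1F (2F , c) → Eventually λ m → 1ℚ ≤ leads wH a b c m
    leads-≥1 l a b c A B C =
      always (λ m p q r → ≤-by-difference (ℚ.+-mono-≤ (ℚ.+-mono-≤ p q) r)
        (solve 9 (λ x₁ x₂ x₃ a₀ a₁ b₀ b₁ c₀ c₁ →
            ((a₀ :- a₁) :+ (b₀ :- b₁) :+ (c₀ :- c₁)) :- con 1ℚ :=
            ((x₁ :+ a₀) :+ (x₂ :+ b₀) :+ (x₃ :+ c₀))
              :- ((x₂ :+ a₁ :+ con ⅓) :+ (x₃ :+ b₁ :+ con ⅓) :+ (x₁ :+ c₁ :+ con ⅓))) refl
          (seq (X wH l 0F) m) (seq (X wH l 1F) m) (seq (X wH l 2F) m)
          _ _ _ _ _ _))
      ⊛ beats l (0F , a) 1F A ⊛ beats l (1F , b) 1F B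
      ⊛ beats l (2F , c) 1F C

    leads-≤-1 : ∀ l a b c → Wins l 0F (0F , a) → Wins l 0F (1F , b) →
      Wins l 0F (2F , c) → Eventually λ m → leads wH a b c m + 1ℚ ≤ 0ℚ
    leads-≤-1 l a b c A B C =
      always (λ m p q r → ≤-by-difference (ℚ.+-mono-≤ (ℚ.+-mono-≤ p q) r)
        (solve 9 (λ x₁ x₂ x₃ a₀ a₁ b₀ b₁ c₀ c₁ →
            con 0ℚ :- (((a₀ :- a₁) :+ (b₀ :- b₁) :+ (c₀ :- c₁)) :+ con 1ℚ) :=
            ((x₂ :+ a₁) :+ (x₃ :+ b₁) :+ (x₁ :+ c₁))
              :- ((x₁ :+ a₀ :+ con ⅓) :+ (x₂ :+ b₀ :+ con ⅓) :+ (x₃ :+ c₀ :+ con ⅓))) refl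
          (seq (X wH l 0F) m) (seq (X wH l 1F) m) (seq (X wH l 2F) m)
          _ _ _ _ _ _))
      ⊛ beats l (0F , a) 0F A ⊛ beats l (1F , b) 0F B
      ⊛ beats l (2F , c) 0F C

  p-wins-A : ∀ t → Wins (0F , t) 1F (0F , t)
  p-wins-A t = ℕ.≤-reflexive (eq (offset (toℕ t)))
    where
    eq : ∀ b → suc (3 ℕ.+ 2 ℕ.* b ℕ.+ 1) ≡ 1 ℕ.+ (4 ℕ.+ 2 ℕ.* b)
    eq = solve-∀

  p-wins-B : ∀ t → Wins (0F , t) 1F (1F , t)
  p-wins-B t = ℕ.≤-reflexive (eq (offset (toℕ t)))
    where
    eq : ∀ b → suc (2 ℕ.+ b ℕ.+ suc b) ≡ 3 ℕ.+ 2 ℕ.* b ℕ.+ 1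
    eq = solve-∀

  p-wins-C : ∀ t → Wins (0F , t) 1F (2F , t)
  p-wins-C t = ℕ.≤-reflexive (eq (offset (toℕ t)))
    where
    eq : ∀ b → suc (1 ℕ.+ suc b) ≡ 2 ℕ.+ b ℕ.+ 1
    eq = solve-∀

  q-wins-A : ∀ t → Wins (1F , t) 0F (0F , t)
  q-wins-A t = ℕ.≤-reflexive (eq (offset (toℕ t)))
    where
    eq : ∀ b → suc (2 ℕ.+ (4 ℕ.+ 2 ℕ.* b)) ≡ 6 ℕ.+ 2 ℕ.* b ℕ.+ 1
    eq = solve-∀

  q-wins-B : ∀ (t : Fin n) → Wins (1F , inject₁ t) 0F (1F , suc t)
  q-wins-B t rewrite Fin.toℕ-inject₁ t = ℕ.≤-reflexive (eq (offset (toℕ t)))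
    where
    eq : ∀ b → suc (6 ℕ.+ 2 ℕ.* b ℕ.+ 1) ≡ 1 ℕ.+ (7 ℕ.+ 2 ℕ.* b)
    eq = solve-∀

  q-wins-C : ∀ t → Wins (1F , t) 0F (2F , zero)
  q-wins-C t = ℕ.≤-refl

  r-wins-A : ∀ t → Wins (2F , t) 0F (0F , t)
  r-wins-A t = ℕ.≤-reflexive (eq (offset (toℕ t)))
    where
    eq : ∀ b → suc (1 ℕ.+ (4 ℕ.+ 2 ℕ.* b)) ≡ 5 ℕ.+ 2 ℕ.* b ℕ.+ 1
    eq = solve-∀

  r-wins-B : ∀ t → Wins (2F , t) 0F (1F , zero)
  r-wins-B t = ℕ.≤-refl

  r-wins-C : ∀ (t : Fin n) → Wins (2F , inject₁ t) 0F (2F , suc t)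
  r-wins-C t rewrite Fin.toℕ-inject₁ t = ℕ.≤-reflexive (eq (offset (toℕ t)))
    where
    eq : ∀ b → suc (6 ℕ.+ 2 ℕ.* b ℕ.+ 1) ≡ 1 ℕ.+ (7 ℕ.+ 2 ℕ.* b)
    eq = solve-∀

  module _ (wH : Weighting digraph) (gap1 : IsGap1Preserver baseWeight wH) where

    doubling : ∀ t → Eventually λ m → fromℕ (2 ℕ.^ toℕ t) ≤ leads wH t zero zero m
    doubling = <-weakInduction (λ t → Eventually λ m → fromℕ (2 ℕ.^ toℕ t) ≤ leads wH t zero zero m)
      (leads-≥1 wH gap1 (0F , zero) zero zero zero
        (p-wins-A zero) (p-wins-B zero) (p-wins-C zero))
      step
      where
      step : ∀ (t : Fin n) → Eventually (λ m → fromℕ (2 ℕ.^ toℕ (inject₁ t)) ≤ leads wH (inject₁ t) zero zero m) →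
        Eventually λ m → fromℕ (2 ℕ.^ suc (toℕ t)) ≤ leads wH (suc t) zero zero m
      step t ih =
        always (λ m p q r d → subst (_≤ leads wH (suc t) zero zero m) (sym 2^suc)
          (≤-by-difference
            (ℚ.+-mono-≤ (ℚ.+-mono-≤ (ℚ.+-mono-≤ p q) r) (ℚ.+-mono-≤ (ℚ.+-mono-≤ d d) (ℚ.nonNegative⁻¹ (fromℕ 3))))
            (solve 7 (λ a a′ b b′ c c′ x →
               ((a′ :+ b) :+ c) :- (x :+ x) :=
               (((((a′ :+ b′) :+ c′) :+ con 0ℚ) :+ con 0ℚ) :+ ((((a :+ b) :+ c) :+ ((a :+ b) :+ c)) :+ con (fromℕ 3)))
               :- (((con 1ℚ :+ (((a :+ b′) :+ c) :+ con 1ℚ)) :+ (((a :+ b) :+ c′) :+ con 1ℚ)) :+ ((x :+ x) :+ con 0ℚ)))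
              refl (lead wH (0F , inject₁ t) m) (lead wH (0F , suc t) m)
                   (lead wH (1F , zero) m) (lead wH (1F , suc t) m)
                   (lead wH (2F , zero) m) (lead wH (2F , suc t) m)
                   (fromℕ (2 ℕ.^ toℕ (inject₁ t))))))
        ⊛ leads-≥1 wH gap1 (0F , suc t) (suc t) (suc t) (suc t)
            (p-wins-A (suc t)) (p-wins-B (suc t)) (p-wins-C (suc t))
        ⊛ leads-≤-1 wH gap1 (1F , inject₁ t) (inject₁ t) (suc t) zero
            (q-wins-A (inject₁ t)) (q-wins-B t) (q-wins-C (inject₁ t))
        ⊛ leads-≤-1 wH gap1 (2F , inject₁ t) (inject₁ t) zero (suc t)
            (r-wins-A (inject₁ t)) (r-wins-B (inject₁ t)) (r-wins-C t)
        ⊛ ih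
        where
        2^suc : fromℕ (2 ℕ.^ suc (toℕ t)) ≡ fromℕ (2 ℕ.^ toℕ (inject₁ t)) + fromℕ (2 ℕ.^ toℕ (inject₁ t))
        2^suc rewrite Fin.toℕ-inject₁ t =
          trans (cong (λ k → fromℕ (2 ℕ.^ toℕ t ℕ.+ k)) (ℕ.+-identityʳ _)) (fromℕ-homo-+ (2 ℕ.^ toℕ t) (2 ℕ.^ toℕ t))

  lead-≤-max : ∀ wH k → Eventually λ m → lead wH k m ≤ seq (maxWeight wH) m
  lead-≤-max wH k = let ε , 0<ε , N , pos = positive wH (encode (inj₂ (k , 1F))) in
    N , λ m N≤m → ≤-by-difference
      (ℚ.+-mono-≤ (ℚ.+-mono-≤ (≤-foldr-⊔ᴿ (weight wH) (encode (inj₂ (k , 0F))) m) (pos m N≤m)) (ℚ.<⇒≤ 0<ε))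
      (solve 4 (λ M y₀ y₁ ε → M :- (y₀ :- y₁) := (M :+ y₁ :+ ε) :- (y₀ :+ (con 0ℚ :+ ε) :+ con 0ℚ)) refl
        (seq (maxWeight wH) m) (seq (Y wH k 0F) m) (seq (Y wH k 1F) m) ε)

max-≥-2^suc : ∀ i (wH : Weighting (graph (Construction.dag (3 ℕ.+ i)))) →
  IsGap1Preserver (w (Construction.dag (3 ℕ.+ i))) wH →
  Eventually λ m → fromℕ (2 ℕ.^ suc i) ≤ seq (maxWeight wH) m
max-≥-2^suc i wH gap1 =
  always (λ m d a b c → ℚ.*-cancelˡ-≤-pos (fromℕ 3) (≤-by-difference
    (ℚ.+-mono-≤ (ℚ.+-mono-≤ (subst (_≤ leads wH top zero zero m) 2^top d) (ℚ.+-mono-≤ (ℚ.+-mono-≤ a b) c)) 0≤P)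
    (solve 5 (λ a b c M P →
        con (fromℕ 3) :* M :- con (fromℕ 3) :* P :=
        ((((a :+ b) :+ c) :+ ((M :+ M) :+ M)) :+ P) :- (((con (fromℕ 4) :* P) :+ ((a :+ b) :+ c)) :+ con 0ℚ))
      refl (lead wH (0F , top) m) (lead wH (1F , zero) m) (lead wH (2F , zero) m)
      (seq (maxWeight wH) m) P)))
  ⊛ doubling wH gap1 top
  ⊛ lead-≤-max wH (0F , top) ⊛ lead-≤-max wH (1F , zero) ⊛ lead-≤-max wH (2F , zero)
  where
  open Construction (3 ℕ.+ i)
  top : Fin (suc (3 ℕ.+ i))
  top = Fin.fromℕ (3 ℕ.+ i)
  P = fromℕ (2 ℕ.^ suc i)
  0≤P : 0ℚ ≤ P
  0≤P = fromℕ-mono-≤ ℕ.z≤n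
  2^top : fromℕ (2 ℕ.^ toℕ top) ≡ fromℕ 4 * P
  2^top rewrite Fin.toℕ-fromℕ i =
    trans (cong fromℕ (sym (ℕ.*-assoc 2 2 (2 ℕ.^ suc i)))) (fromℕ-homo-* 4 (2 ℕ.^ suc i))

rate : ℚ
rate = + 1 / 27

exponent-≤ : ∀ i → rate * (+ ∣V∣ (Construction.dag (3 ℕ.+ i)) / 1) ≤ fromℕ (suc i)
exponent-≤ i = begin
  rate * (+ V / 1)                   ≡⟨ cong (λ q → rate * q) (ℚ.↥p/↧p≡p (fromℕ V)) ⟩
  rate * fromℕ V                     ≤⟨ ℚ.*-monoˡ-≤-nonNeg rate (fromℕ-mono-≤ V≤27+27i) ⟩
  rate * fromℕ (27 ℕ.* suc i)        ≡⟨ cong (λ q → rate * q) (fromℕ-homo-* 27 (suc i)) ⟩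
  rate * (fromℕ 27 * fromℕ (suc i))  ≡⟨ ℚ.*-assoc rate (fromℕ 27) (fromℕ (suc i)) ⟨
  1ℚ * fromℕ (suc i)                 ≡⟨ ℚ.*-identityˡ _ ⟩
  fromℕ (suc i)                      ∎
  where
  open ℚ.≤-Reasoning
  V = ∣V∣ (Construction.dag (3 ℕ.+ i))
  V+21i : ∀ i → 3 ℕ.* (4 ℕ.+ i) ℕ.+ 3 ℕ.+ 3 ℕ.* (4 ℕ.+ i) ℕ.+ 21 ℕ.* i ≡ 27 ℕ.* suc i
  V+21i = solve-∀
  V≤27+27i : V ℕ.≤ 27 ℕ.* suc i
  V≤27+27i = ℕ.≤-trans (ℕ.m≤m+n V (21 ℕ.* i)) (ℕ.≤-reflexive (V+21i i))

theorem1p5 : ∃ λ (c : ℚ) → 0ℚ < c × (∃ λ (G : ℕ → Weighted3LayeredDAG) →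
    (∀ N → ∃ λ i → N ℕ.≤ ∣V∣ (G i)) ×
    (∀ i → ∣V₂∣ (G i) ≡ 3 ×
    (∀ (wH : Weighting (graph (G i))) → IsGap1Preserver (w (G i)) wH →
    2^ (c * (+ ∣V∣ (G i) / 1)) ≤ᴿ maxWeight wH)))
theorem1p5 = rate , ℚ.positive⁻¹ rate , (λ i → Construction.dag (3 ℕ.+ i)) ,
  (λ N → N , ℕ.≤-trans (ℕ.m≤n+m N 4) (ℕ.≤-trans (ℕ.m≤n*m (4 ℕ.+ N) 3)
    (ℕ.m≤n+m (3 ℕ.* (4 ℕ.+ N)) (3 ℕ.* (4 ℕ.+ N) ℕ.+ 3)))) ,
  λ i → refl , λ wH gap1 ε 0<ε →
    always (λ m le → ≤+pos 0<ε (ℚ.≤-trans (2^-≤ _ (suc i) (exponent-≤ i) m) le)) ⊛ max-≥-2^suc i wH gap1
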